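{- Let $X$ be a compact metric space with metric $\rho$ and let $k\ge 1$ be an integer. Then $\dim_L(X)\le k-1$ if and only if for every $\epsilon>0$ there exist a number $\delta$ with $0<\delta<\epsilon$ and a hypergraph $\mathcal{H}(\epsilon)$ on a finite vertex set $V(\mathcal{H}(\epsilon))$ with edge set $E(\mathcal{H}(\epsilon))=\{e_x : x\in X\}$ (a family of subsets of $V(\mathcal{H}(\epsilon))$ indexed by the points of $X$) such that: 1) the rank of $\mathcal{H}(\epsilon)$ is at most $k$; 2) $e_x\cap e_y\neq\emptyset$ for all $x,y\in X$ with $\rho(x,y)<\delta$; 3) $\rho(x,y)<\epsilon$ for all $x,y\in X$ with $e_x\cap e_y\neq\emptyset$; 4) for every $v\in V(\mathcal{H}(\epsilon))$ the set $X_v=\{x\in X : v\in e_x\}$ is open in $X$.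
   Context: The rank of a hypergraph is the maximal size of its edges. A cover of a compact metric space $X$ is a family $\mathcal{C}$ of open subsets of $X$ whose union is $X$. A cover is a $k$-cover if every $x\in X$ belongs to at most $k$ sets of $\mathcal{C}$; an $\epsilon$-cover if every set in $\mathcal{C}$ has diameter at most $\epsilon$; an $(\epsilon,k)$-cover if it is both an $\epsilon$-cover and a $k$-cover. The Lebesgue (covering) dimension $\dim_L(X)$ is the minimal integer $k$ such that for every $\epsilon>0$ there exists an $(\epsilon,k+1)$-cover of $X$. The sets $e_x$ for different points $x$ are allowed to coincide as sets. -}

module Defs where

open import Level using (Level; _⊔_) renaming (zero to 0ℓ; suc to lsuc)
open import Data.Nat.Base as ℕ using (ℕ)
open import Data.Integer.Base as ℤ using (ℤ; +_; 1ℤ; -1ℤ)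
open import Data.Rational.Base as ℚ using (ℚ; 0ℚ; 1ℚ)
import Data.Rational.Properties as ℚ
open import Data.Fin.Base using (Fin)
open import Data.Fin.Subset using (∣_∣) renaming (Subset to FinSubset; _∈_ to _∈ᶠ_)
open import Data.List.Base using (List; length)
open import Data.List.Relation.Unary.All using (All)
open import Data.List.Relation.Unary.Any using (Any)
open import Data.List.Relation.Unary.AllPairs using (AllPairs)
open import Data.Product.Base using (Σ; ∃; ∃-syntax; ∃₂; _×_; _,_)
open import Data.Sum.Base using (_⊎_)
open import Function.Metric.Structures using (IsGeneralMetric)
open import Relation.Binary.Core using (Rel)
open import Relation.Binary.Definitions using (tri<; tri≈; tri>)
open import Relation.Binary.PropositionalEquality
  using (_≡_; refl; sym; trans; cong; subst)
open import Relation.Nullary.Negation using (¬_)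
open import Relation.Unary using (Pred; _∈_; _∉_; _⊆_; _≐_)

------------------------------------------------------------------------
-- Real numbers as Dedekind cuts, represented by the lower set alone.
-- Without the upper set this is the classical notion: it is intended to
-- be used together with excluded middle.

record ℝ : Set₁ where
  field
    lower     : Pred ℚ 0ℓ
    inhabited : ∃[ q ] q ∈ lower
    bounded   : ∃[ q ] q ∉ lower
    down      : ∀ {p q} → p ℚ.< q → q ∈ lower → p ∈ lower
    rounded   : ∀ {p} → p ∈ lower → ∃[ q ] p ℚ.< q × q ∈ lower

open ℝ public

infix 4 _≈ᵣ_ _≤ᵣ_ _<ᵣ_

_≈ᵣ_ : Rel ℝ 0ℓ
x ≈ᵣ y = lower x ≐ lower y

_≤ᵣ_ : Rel ℝ 0ℓ
x ≤ᵣ y = lower x ⊆ lower y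

_<ᵣ_ : Rel ℝ 0ℓ
x <ᵣ y = ∃[ q ] q ∉ lower x × q ∈ lower y

fromℚ : ℚ → ℝ
fromℚ r = record
  { lower     = ℚ._< r
  ; inhabited = r ℚ.- 1ℚ ,
      subst (r ℚ.- 1ℚ ℚ.<_) (ℚ.+-identityʳ r) (ℚ.+-monoʳ-< r (ℚ.negative⁻¹ (ℚ.- 1ℚ)))
  ; bounded   = r , ℚ.<-irrefl refl
  ; down      = ℚ.<-trans
  ; rounded   = ℚ.<-dense
  }

0ᵣ : ℝ
0ᵣ = fromℚ 0ℚ

∈∉⇒< : ∀ (x : ℝ) {p q} → p ∈ lower x → q ∉ lower x → p ℚ.< q
∈∉⇒< x {p} {q} p∈ q∉ with ℚ.<-cmp p q
... | tri< p<q _ _ = p<q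
... | tri≈ _ refl _ with () ← q∉ p∈
... | tri> _ _ q<p with () ← q∉ (down x q<p p∈)

infixl 6 _+ᵣ_

_+ᵣ_ : ℝ → ℝ → ℝ
x +ᵣ y = record
  { lower     = λ r → ∃₂ λ a b → a ∈ lower x × b ∈ lower y × r ≡ a ℚ.+ b
  ; inhabited = let a , a∈ = inhabited x ; b , b∈ = inhabited y
                in a ℚ.+ b , a , b , a∈ , b∈ , refl
  ; bounded   = let p , p∉ = bounded x ; q , q∉ = bounded y
                in p ℚ.+ q , λ (a , b , a∈ , b∈ , eq) →
                     ℚ.<-irrefl (sym eq) (ℚ.+-mono-< (∈∉⇒< x a∈ p∉) (∈∉⇒< y b∈ q∉))
  ; down      = λ { {r} r<s (a , b , a∈ , b∈ , refl) →
                     r ℚ.- b , b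
                   , down x (subst (r ℚ.- b ℚ.<_) (cancel a b) (ℚ.+-monoˡ-< (ℚ.- b) r<s)) a∈
                   , b∈ , sym (cancel′ r b) }
  ; rounded   = λ { (a , b , a∈ , b∈ , refl) →
                     let a′ , a<a′ , a′∈ = rounded x a∈
                     in a′ ℚ.+ b , ℚ.+-monoˡ-< b a<a′ , a′ , b , a′∈ , b∈ , refl }
  }
  where
  cancel : ∀ a b → a ℚ.+ b ℚ.- b ≡ a
  cancel a b = trans (ℚ.+-assoc a b (ℚ.- b))
              (trans (cong (a ℚ.+_) (ℚ.+-inverseʳ b)) (ℚ.+-identityʳ a))

  cancel′ : ∀ r b → r ℚ.- b ℚ.+ b ≡ r
  cancel′ r b = trans (ℚ.+-assoc r (ℚ.- b) b)
               (trans (cong (r ℚ.+_) (ℚ.+-inverseˡ b)) (ℚ.+-identityʳ r))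

------------------------------------------------------------------------
-- Metric spaces.  As in Function.Metric, points are compared by an
-- equivalence _≈_, and ρ x y is zero exactly when x ≈ y.

record MetricSpace c ℓ : Set (lsuc (c ⊔ ℓ ⊔ lsuc 0ℓ)) where
  infix 4 _≈_
  field
    Carrier  : Set c
    _≈_      : Rel Carrier ℓ
    ρ        : Carrier → Carrier → ℝ
    isMetric : IsGeneralMetric _≈_ _≈ᵣ_ _≤ᵣ_ 0ᵣ _+ᵣ_ ρ

module _ {c ℓ} (X : MetricSpace c ℓ) where
  open MetricSpace X

  -- An open set automatically respects _≈_, since ρ x y is zero for x ≈ y.
  IsOpen : ∀ {p} → Pred Carrier p → Set (c ⊔ p ⊔ lsuc 0ℓ)
  IsOpen U = ∀ x → x ∈ U → ∃[ r ] 0ᵣ <ᵣ r × (∀ y → ρ x y <ᵣ r → y ∈ U)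

  Subset : Set (lsuc (c ⊔ ℓ))
  Subset = Pred Carrier (c ⊔ ℓ)

  Family : Set (lsuc (lsuc (c ⊔ ℓ)))
  Family = Pred Subset (lsuc (c ⊔ ℓ))

  record IsCover (𝒞 : Family) : Set (lsuc (c ⊔ ℓ)) where
    field
      open-sets : ∀ U → U ∈ 𝒞 → IsOpen U
      covers    : ∀ x → ∃[ U ] U ∈ 𝒞 × x ∈ U

  Compact : Set (lsuc (lsuc (c ⊔ ℓ)))
  Compact = ∀ 𝒞 → IsCover 𝒞 →
    ∃[ Us ] All (_∈ 𝒞) Us × (∀ x → Any (x ∈_) Us)

  -- Sets are counted up to extensional equality.
  IsMultiplicityCover : ℤ → Family → Set (lsuc (c ⊔ ℓ))
  IsMultiplicityCover k 𝒞 = ∀ x (Us : List Subset) →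
    All (_∈ 𝒞) Us → All (x ∈_) Us → AllPairs (λ U V → ¬ (U ≐ V)) Us →
    + length Us ℤ.≤ k

  -- The supremum is taken among the nonnegative reals, so that the empty
  -- set has diameter zero.  An unbounded set has no diameter.
  record IsDiameter (U : Subset) (d : ℝ) : Set (c ⊔ ℓ ⊔ lsuc 0ℓ) where
    field
      nonneg : 0ᵣ ≤ᵣ d
      upper  : ∀ x y → x ∈ U → y ∈ U → ρ x y ≤ᵣ d
      least  : ∀ b → 0ᵣ ≤ᵣ b → (∀ x y → x ∈ U → y ∈ U → ρ x y ≤ᵣ b) → d ≤ᵣ b

  IsMeshCover : ℝ → Family → Set (lsuc (c ⊔ ℓ))
  IsMeshCover ε 𝒞 = ∀ U → U ∈ 𝒞 → ∃[ d ] IsDiameter U d × d ≤ᵣ ε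

  HasFineCovers : ℤ → Set (lsuc (lsuc (c ⊔ ℓ)))
  HasFineCovers k = ∀ ε → 0ᵣ <ᵣ ε →
    ∃[ 𝒞 ] IsCover 𝒞 × IsMeshCover ε 𝒞 × IsMultiplicityCover k 𝒞

  -- The bound -1 matters only for the empty space, whose dimension is -1;
  -- otherwise every negative integer would qualify and there would be no
  -- minimum.
  record IsLebesgueDimension (d : ℤ) : Set (lsuc (lsuc (c ⊔ ℓ))) where
    field
      -1≤d          : -1ℤ ℤ.≤ d
      hasFineCovers : HasFineCovers (d ℤ.+ 1ℤ)
      minimal       : ∀ d′ → -1ℤ ℤ.≤ d′ → HasFineCovers (d′ ℤ.+ 1ℤ) → d ℤ.≤ d′

  -- A space without a Lebesgue dimension is infinite-dimensional.
  LebesgueDimension≤ : ℤ → Set (lsuc (lsuc (c ⊔ ℓ)))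
  LebesgueDimension≤ n = ∃[ d ] IsLebesgueDimension d × d ℤ.≤ n

  -- Hypergraphs whose edges are indexed by the points of X; different
  -- points may have the same edge.
  record Hypergraph : Set (c ⊔ ℓ) where
    field
      order     : ℕ
      edge      : Carrier → FinSubset order
      edge-cong : ∀ {x y} → x ≈ y → edge x ≡ edge y

    Vertex : Set
    Vertex = Fin order

    Star : Vertex → Pred Carrier 0ℓ
    Star v x = v ∈ᶠ edge x

    -- The maximum of the edge sizes, which is zero if there are no edges.
    record IsRank (r : ℕ) : Set c where
      field
        upper    : ∀ x → ∣ edge x ∣ ℕ.≤ r
        attained : (∃[ x ] ∣ edge x ∣ ≡ r) ⊎ (¬ Carrier × r ≡ 0)

    Rank≤ : ℤ → Set c
    Rank≤ k = ∃[ r ] IsRank r × + r ℤ.≤ k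

{-# OPTIONS --safe #-}
module Submission where

-- From dimension to hypergraphs: take a finite subcover of a fine cover, list
-- its members without repetition, and let e_x be the set of members containing
-- x; then X_v is the v-th member and a Lebesgue number of the subcover serves
-- as δ.  Conversely, the sets X_v of ℋ(ε) form an (ε,k)-cover, because every
-- X_v containing x has v ∈ e_x, and distinct sets come from distinct vertices.

open import Defs
open import Axiom.ExcludedMiddle using (ExcludedMiddle)
open import Data.Fin.Subset using (Nonempty; _∩_)
open import Data.Integer.Base using (ℤ; 1ℤ; _≤_; _-_)
open import Data.Product.Base using (Σ; ∃-syntax; _×_)
open import Function.Bundles using (_⇔_)

import Algebra.Properties.AbelianGroup as AbelianGroupProperties
open import Data.Fin.Base using (Fin; zero; suc)
open import Data.Fin.Subset using (∣_∣; _⊆_) renaming (Subset to FinSubset; _∈_ to _∈ᶠ_; _-_ to _∖_)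
open import Data.Fin.Subset.Properties
  using (⊆-antisym; x∈p∩q⁺; x∈p∩q⁻; x∈p∧x≢y⇒x∈p-y; x∈p⇒∣p-x∣<∣p∣; drop-there)
import Data.Integer.Base as ℤ
import Data.Integer.Properties as ℤ
open import Data.List.Base using (List; []; _∷_; length; lookup; filter; deduplicate)
open import Data.List.Membership.Propositional.Properties using (∈-lookup)
open import Data.List.Relation.Unary.All as All using (All; []; _∷_)
import Data.List.Relation.Unary.All.Properties as All
open import Data.List.Relation.Unary.AllPairs using (AllPairs; []; _∷_)
import Data.List.Relation.Unary.AllPairs.Properties as AllPairs
open import Data.List.Relation.Unary.Any as Any using (Any; here; there)
import Data.List.Relation.Unary.Any.Properties as Any
open import Data.List.Relation.Unary.Unique.DecSetoid.Properties using (deduplicate-!)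
open import Data.Nat.Base as ℕ using (ℕ; zero; suc; z≤n; s≤s)
import Data.Nat.Properties as ℕ
open import Data.Product.Base using (_,_; proj₁; proj₂)
open import Data.Rational.Base as ℚ using (ℚ; 0ℚ; 1ℚ; _⊓_)
import Data.Rational.Properties as ℚ
open import Data.Sum.Base using (_⊎_; inj₁; inj₂)
open import Data.Vec.Base using (here; there; []; _∷_)
open import Function.Base using (_∘_)
open import Function.Bundles using (mk⇔)
open import Function.Metric.Structures using (IsGeneralMetric)
open import Level using (Level; _⊔_; Lift; lift)
open import Relation.Binary.Bundles using (DecSetoid)
open import Relation.Binary.Core using (Rel)
open import Relation.Binary.PropositionalEquality using (_≡_; refl; sym; cong; subst)
open import Relation.Nullary using (¬_; does; yes; no; contradiction)
open import Relation.Nullary.Decidable using (True; toWitness; fromWitness)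
open import Relation.Unary using (Pred; Decidable; _∈_; _∉_; _≐_)
open import Relation.Unary.Properties using (≐-refl)
open import Relation.Unary.Relation.Binary.Equality using (≐-isEquivalence)

private
  variable
    a p r : Level
    A : Set a

-- Finite index sets and counting.

module _ {P : Pred A p} (P? : Decidable P) where

  selection : (xs : List A) → FinSubset (length xs)
  selection []       = []
  selection (x ∷ xs) = does (P? x) ∷ selection xs

  ∣selection∣ : ∀ xs → ∣ selection xs ∣ ≡ length (filter P? xs)
  ∣selection∣ [] = refl
  ∣selection∣ (x ∷ xs) with P? x
  ... | yes _ = cong suc (∣selection∣ xs)
  ... | no  _ = ∣selection∣ xs

  ∈-selection⁺ : ∀ xs i → P (lookup xs i) → i ∈ᶠ selection xs
  ∈-selection⁺ (x ∷ xs) zero    px with P? x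
  ... | yes _  = here
  ... | no ¬px = contradiction px ¬px
  ∈-selection⁺ (x ∷ xs) (suc i) px = there (∈-selection⁺ xs i px)

  ∈-selection⁻ : ∀ xs i → i ∈ᶠ selection xs → P (lookup xs i)
  ∈-selection⁻ (x ∷ xs) zero    i∈ with P? x | i∈
  ... | yes px | _  = px
  ... | no  _  | ()
  ∈-selection⁻ (x ∷ xs) (suc i) i∈ = ∈-selection⁻ xs i (drop-there i∈)

-- Induction on the list, deleting from `q` the vertex `v` that yields the head. Irreflexivity of
-- `R` replaces injectivity of `f`: a later entry is `R`-related to `f v`, so it cannot come from
-- `v` and still has a source in `q ∖ v`.
length≤∣∣ : ∀ {n} (f : Fin n → A) (R : Rel A r) → (∀ v → ¬ R (f v) (f v)) →
            ∀ q xs → All (λ x → ∃[ v ] v ∈ᶠ q × x ≡ f v) xs → AllPairs R xs →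
            length xs ℕ.≤ ∣ q ∣
length≤∣∣ f R irr q []       _                        _          = z≤n
length≤∣∣ f R irr q (_ ∷ xs) ((v , v∈q , refl) ∷ pxs) (rx ∷ rxs) =
  ℕ.≤-<-trans (length≤∣∣ f R irr (q ∖ v) xs (All.zipWith avoid (pxs , rx)) rxs)
              (x∈p⇒∣p-x∣<∣p∣ v∈q)
  where
  avoid : ∀ {x} → (∃[ w ] w ∈ᶠ q × x ≡ f w) × R (f v) x →
          ∃[ w ] w ∈ᶠ q ∖ v × x ≡ f w
  avoid ((w , w∈q , refl) , rvw) =
    w , x∈p∧x≢y⇒x∈p-y w∈q (λ { refl → irr v rvw }) , refl

-- Rational arithmetic and the order on Dedekind cuts.

p+[q-p]≡q : ∀ p q → p ℚ.+ (q ℚ.- p) ≡ q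
p+[q-p]≡q p q = subst (_≡ q) (ℚ.+-assoc p q (ℚ.- p)) (xyx⁻¹≈y p q)
  where open AbelianGroupProperties ℚ.+-0-abelianGroup

p<q⇒0<q-p : ∀ {p q} → p ℚ.< q → 0ℚ ℚ.< q ℚ.- p
p<q⇒0<q-p {p} {q} p<q = subst (ℚ._< q ℚ.- p) (ℚ.+-inverseʳ p) (ℚ.+-monoˡ-< (ℚ.- p) p<q)

0<⊓ : ∀ {p q} → 0ℚ ℚ.< p → 0ℚ ℚ.< q → 0ℚ ℚ.< p ⊓ q
0<⊓ {p} {q} 0<p 0<q with ℚ.⊓-sel p q
... | inj₁ eq = subst (0ℚ ℚ.<_) (sym eq) 0<p
... | inj₂ eq = subst (0ℚ ℚ.<_) (sym eq) 0<q

<-≤-transᵣ : ∀ x y z → x <ᵣ y → y ≤ᵣ z → x <ᵣ z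
<-≤-transᵣ _ _ _ (q , q∉x , q∈y) y≤z = q , q∉x , y≤z q∈y

≤-<-transᵣ : ∀ x y z → x ≤ᵣ y → y <ᵣ z → x <ᵣ z
≤-<-transᵣ _ _ _ x≤y (q , q∉y , q∈z) = q , q∉y ∘ x≤y , q∈z

<⇒≤ᵣ : ∀ x y → x <ᵣ y → x ≤ᵣ y
<⇒≤ᵣ x y (q , q∉x , q∈y) p∈x = down y (∈∉⇒< x p∈x q∉x) q∈y

fromℚ-mono-≤ : ∀ {p q} → p ℚ.≤ q → fromℚ p ≤ᵣ fromℚ q
fromℚ-mono-≤ p≤q s<p = ℚ.<-≤-trans s<p p≤q

0<fromℚ : ∀ {q} → 0ℚ ℚ.< q → 0ᵣ <ᵣ fromℚ q
0<fromℚ 0<q = 0ℚ , ℚ.<-irrefl refl , 0<q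

∈⇒fromℚ< : ∀ (x : ℝ) {q} → q ∈ lower x → fromℚ q <ᵣ x
∈⇒fromℚ< x {q} q∈x = q , ℚ.<-irrefl refl , q∈x

∈⇒fromℚ≤ : ∀ (x : ℝ) {q} → q ∈ lower x → fromℚ q ≤ᵣ x
∈⇒fromℚ≤ x q∈x s<q = down x s<q q∈x

positive-rational-below : ∀ x → 0ᵣ <ᵣ x → ∃[ q ] 0ℚ ℚ.< q × q ∈ lower x
positive-rational-below x (p , p≮0 , p∈x) =
  -- The witness `p` may be zero; rounding it up inside the cut makes it strictly positive.
  let q , p<q , q∈x = rounded x p∈x in q , ℚ.≤-<-trans (ℚ.≮⇒≥ p≮0) p<q , q∈x

∉-+ᵣ : ∀ x y {p q} → p ∉ lower x → q ∉ lower y → p ℚ.+ q ∉ lower (x +ᵣ y)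
∉-+ᵣ x y p∉x q∉y (a , b , a∈x , b∈y , eq) =
  ℚ.<-irrefl (sym eq) (ℚ.+-mono-< (∈∉⇒< x a∈x p∉x) (∈∉⇒< y b∈y q∉y))

-- Rational balls and Lebesgue numbers.

module _ {c ℓ} (X : MetricSpace c ℓ) where
  open MetricSpace X
  open IsGeneralMetric isMetric using (triangle; ≈⇒0; module EqC)

  infix 4 _<[_]_
  _<[_]_ : Carrier → ℚ → Carrier → Set
  x <[ q ] y = ρ x y <ᵣ fromℚ q

  ρ-< : ∀ r {x y} → x ≈ y → 0ᵣ <ᵣ r → ρ x y <ᵣ r
  ρ-< r {x} {y} x≈y = ≤-<-transᵣ (ρ x y) 0ᵣ r (proj₁ (≈⇒0 x≈y))

  -- A rational outside the lower cut of a distance is an upper bound for that distance. The sum of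
  -- two such bounds lies outside the cut of the sum, which contains the cut of `ρ x z`.
  triangle-∉ : ∀ x y z {p q} → p ∉ lower (ρ x y) → q ∉ lower (ρ y z) → p ℚ.+ q ∉ lower (ρ x z)
  triangle-∉ x y z p∉ q∉ = ∉-+ᵣ (ρ x y) (ρ y z) p∉ q∉ ∘ triangle x y z

  triangle-< : ∀ {x y z p q} → x <[ p ] y → y <[ q ] z → x <[ p ℚ.+ q ] z
  triangle-< {x} {y} {z} (p , p∉ , p<) (q , q∉ , q<) =
    p ℚ.+ q , triangle-∉ x y z p∉ q∉ , ℚ.+-mono-< p< q<

  -- The lift is needed because members of a `Family` live at level `c ⊔ ℓ`, whereas comparisons of
  -- reals are small.
  ball : Carrier → ℚ → Subset X
  ball x q y = Lift (c ⊔ ℓ) (x <[ q ] y)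

  ball-open : ∀ x q → IsOpen X (ball x q)
  ball-open x q y (lift (p , p∉ , p<q)) =
    -- `p` is a rational upper bound of `ρ x y` below `q`, so `q - p` is the room left around `y`.
    fromℚ (q ℚ.- p) , 0<fromℚ (p<q⇒0<q-p p<q) ,
    λ { z (s , s∉ , s<) → lift (p ℚ.+ s , triangle-∉ x y z p∉ s∉ ,
          subst (p ℚ.+ s ℚ.<_) (p+[q-p]≡q p q) (ℚ.+-monoʳ-< p s<)) }

  open-respects-≈ : ∀ {u} {U : Pred Carrier u} → IsOpen X U → ∀ {x y} → x ≈ y → x ∈ U → y ∈ U
  open-respects-≈ U-open {x} {y} x≈y x∈U =
    let r , 0<r , ball⊆U = U-open x x∈U in ball⊆U y (ρ-< r x≈y 0<r)

  -- The least s occurring in a finite subcover by such balls is a Lebesgue number of Us.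
  FattenableBall : List (Subset X) → Family X
  FattenableBall Us B = ∃[ x ] ∃[ q ] ∃[ s ] 0ℚ ℚ.< s × B ≡ ball x q ×
    Any (λ U → ∀ y → x <[ q ℚ.+ s ] y → y ∈ U) Us

  -- Let `x` lie in a ball of the finite subcover and let `y` be closer to `x` than the margin of
  -- that ball. By the triangle inequality both points lie in the fattened ball, hence in a single
  -- member of `Us`.
  lebesgue-number : Compact X → ∀ Us → All (IsOpen X) Us → (∀ x → Any (x ∈_) Us) →
    ∃[ q ] 0ℚ ℚ.< q × (∀ x y → x <[ q ] y → Any (λ U → x ∈ U × y ∈ U) Us)
  lebesgue-number compact Us opens covers =
    let Bs , fat , Bs-cover = compact (FattenableBall Us) isCover
        q , 0<q , number    = finite Bs fat
    in  q , 0<q , λ x y x<y → number x y x<y (Bs-cover x)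
    where
    ball-around : ∀ x {Vs} → All (IsOpen X) Vs → Any (x ∈_) Vs →
      ∃[ q ] 0ℚ ℚ.< q × ∃[ s ] 0ℚ ℚ.< s × Any (λ U → ∀ y → x <[ q ℚ.+ s ] y → y ∈ U) Vs
    ball-around x (U-open ∷ _) (here x∈U) =
      let R , 0<R , ball⊆U = U-open x x∈U
          t , 0<t , t∈R    = positive-rational-below R 0<R
          -- The radius `t` is split in two: `q` for the ball itself and `t - q` for its margin.
          q , 0<q , q<t    = ℚ.<-dense 0<t
      in  q , 0<q , t ℚ.- q , p<q⇒0<q-p q<t ,
          here (λ y x<y → ball⊆U y (<-≤-transᵣ (ρ x y) (fromℚ t) R
            (subst (x <[_] y) (p+[q-p]≡q q t) x<y) (∈⇒fromℚ≤ R t∈R)))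
    ball-around x (_ ∷ opens′) (there x∈Vs) =
      let q , 0<q , s , 0<s , fits = ball-around x opens′ x∈Vs
      in  q , 0<q , s , 0<s , there fits

    isCover : IsCover X (FattenableBall Us)
    isCover = record
      { open-sets = λ { _ (x , q , _ , _ , refl , _) → ball-open x q }
      ; covers    = λ x →
          let q , 0<q , s , 0<s , fits = ball-around x opens (covers x)
          in  ball x q , (x , q , s , 0<s , refl , fits) , lift (ρ-< (fromℚ q) EqC.refl (0<fromℚ 0<q))
      }

    finite : ∀ Bs → All (_∈ FattenableBall Us) Bs →
      ∃[ q ] 0ℚ ℚ.< q ×
        (∀ x y → x <[ q ] y → Any (x ∈_) Bs → Any (λ U → x ∈ U × y ∈ U) Us)
    -- No point lies in an empty list of balls, so any positive number works; the final value is the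
    -- minimum of `1ℚ` and all the margins.
    finite [] [] = 1ℚ , ℚ.positive⁻¹ 1ℚ , λ _ _ _ ()
    finite (_ ∷ Bs) ((z , p , s , 0<s , refl , fits) ∷ fat) =
      let q , 0<q , number = finite Bs fat
      in  s ⊓ q , 0<⊓ 0<s 0<q , λ
        { x y x<y (here (lift z<x)) → Any.map
            (λ ball⊆U → ball⊆U x (shrink p≤p+s z<x)
                      , ball⊆U y (triangle-< z<x (shrink (ℚ.p⊓q≤p s q) x<y)))
            fits
        ; x y x<y (there x∈Bs) → number x y (shrink (ℚ.p⊓q≤q s q) x<y) x∈Bs
        }
      where
      p≤p+s : p ℚ.≤ p ℚ.+ s
      p≤p+s = subst (ℚ._≤ p ℚ.+ s) (ℚ.+-identityʳ p) (ℚ.+-monoʳ-≤ p (ℚ.<⇒≤ 0<s))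

      shrink : ∀ {p q x y} → p ℚ.≤ q → x <[ p ] y → x <[ q ] y
      shrink {p} {q} {x} {y} p≤q x<y =
        <-≤-transᵣ (ρ x y) (fromℚ p) (fromℚ q) x<y (fromℚ-mono-≤ p≤q)

  HasFineCovers-mono : ∀ {j k} → j ≤ k → HasFineCovers X j → HasFineCovers X k
  HasFineCovers-mono j≤k fine ε 0<ε =
    let 𝒞 , cover , mesh , mult = fine ε 0<ε
    in  𝒞 , cover , mesh , λ x Us ∈𝒞 x∈ ≠ → ℤ.≤-trans (mult x Us ∈𝒞 x∈ ≠) j≤k

-- Minima and maxima of natural numbers by excluded middle.

module _ (em : ∀ {a} → ExcludedMiddle a) where

  least : (P : ℕ → Set p) → ∀ n → P n → ∃[ m ] m ℕ.≤ n × P m × (∀ j → P j → m ℕ.≤ j)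
  least P zero    pn = zero , z≤n , pn , λ _ _ → z≤n
  least P (suc n) pn with em {P = P zero}
  ... | yes p0 = zero , z≤n , p0 , λ _ _ → z≤n
  ... | no ¬p0 =
    let m , m≤n , pm , min = least (P ∘ suc) n pn
    in  suc m , s≤s m≤n , pm , λ
      { zero    p0 → contradiction p0 ¬p0
      ; (suc j) pj → s≤s (min j pj) }

  -- The upper bound is lowered one unit at a time until it is attained. The given point of `A`
  -- ensures that the bound 0, if reached, is attained.
  maximum : (f : A → ℕ) → A → ∀ n → (∀ x → f x ℕ.≤ n) →
            ∃[ m ] (∀ x → f x ℕ.≤ m) × ∃[ x ] f x ≡ m
  maximum f x zero    f≤n = zero , f≤n , x , ℕ.n≤0⇒n≡0 (f≤n x)
  maximum f x (suc n) f≤n with em {P = ∃[ y ] f y ≡ suc n}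
  ... | yes attained = suc n , f≤n , attained
  ... | no ¬attained = maximum f x n λ y →
    ℕ.≤-pred (ℕ.≤∧≢⇒< (f≤n y) (λ eq → ¬attained (y , eq)))

  -- Existence of rank, diameter and dimension.

  module _ {c ℓ} (X : MetricSpace c ℓ) where
    open MetricSpace X
    open IsGeneralMetric isMetric using (module EqC)

    rank≤ : (H : Hypergraph X) → ∀ n → (∀ x → ∣ Hypergraph.edge H x ∣ ℕ.≤ n) →
            Hypergraph.Rank≤ H (ℤ.+ n)
    rank≤ H n edge≤n with em {P = Carrier}
    -- Over the empty space there are no edges and the rank is 0 by convention.
    ... | no ¬x = 0 , record { upper = λ x → contradiction x ¬x ; attained = inj₂ (¬x , refl) }
                    , ℤ.+≤+ z≤n
    ... | yes x =
      let m , upper , y , eq = maximum (∣_∣ ∘ Hypergraph.edge H) x n edge≤n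
      in  m , record { upper = upper ; attained = inj₁ (y , eq) }
            , ℤ.+≤+ (subst (ℕ._≤ n) eq (edge≤n y))

    -- The supremum is the union of the cuts of all distances within `U`. Adjoining the negative
    -- rationals makes it nonnegative, and gives the empty set diameter zero.
    diameter : ∀ (U : Subset X) {b} → 0ᵣ ≤ᵣ b → (∀ x y → x ∈ U → y ∈ U → ρ x y ≤ᵣ b) →
               ∃[ d ] IsDiameter X U d × d ≤ᵣ b
    diameter U {b} 0≤b ρ≤b = sup , isDiameter , below {b} 0≤b ρ≤b ∘ toWitness
      where
      Below : Pred ℚ _
      Below q = q ℚ.< 0ℚ ⊎ (∃[ x ] ∃[ y ] x ∈ U × y ∈ U × q ∈ lower (ρ x y))

      below : ∀ {b} → 0ᵣ ≤ᵣ b → (∀ x y → x ∈ U → y ∈ U → ρ x y ≤ᵣ b) →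
              ∀ {q} → Below q → q ∈ lower b
      below 0≤b ρ≤b (inj₁ q<0)                      = 0≤b q<0
      below 0≤b ρ≤b (inj₂ (x , y , x∈U , y∈U , q∈)) = ρ≤b x y x∈U y∈U q∈

      Below-down : ∀ {p q} → p ℚ.< q → Below q → Below p
      Below-down p<q (inj₁ q<0)                      = inj₁ (ℚ.<-trans p<q q<0)
      Below-down p<q (inj₂ (x , y , x∈U , y∈U , q∈)) =
        inj₂ (x , y , x∈U , y∈U , down (ρ x y) p<q q∈)

      Below-rounded : ∀ {p} → Below p → ∃[ q ] p ℚ.< q × Below q
      Below-rounded (inj₁ p<0) =
        let q , p<q , q<0 = ℚ.<-dense p<0 in q , p<q , inj₁ q<0
      Below-rounded (inj₂ (x , y , x∈U , y∈U , p∈)) =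
        let q , p<q , q∈ = rounded (ρ x y) p∈ in q , p<q , inj₂ (x , y , x∈U , y∈U , q∈)

      -- The truth value brings Below down to the universe that cuts require.
      sup : ℝ
      sup = record
        { lower     = λ q → True (em {P = Below q})
        ; inhabited = let q , q<0 = inhabited 0ᵣ in q , fromWitness (inj₁ q<0)
        ; bounded   = let q , q∉b = bounded b in q , q∉b ∘ below {b} 0≤b ρ≤b ∘ toWitness
        ; down      = λ p<q → fromWitness ∘ Below-down p<q ∘ toWitness
        ; rounded   = λ p∈ → let q , p<q , q∈ = Below-rounded (toWitness p∈)
                             in  q , p<q , fromWitness q∈
        }

      isDiameter : IsDiameter X U sup
      isDiameter = record
        { nonneg = λ q<0 → fromWitness (inj₁ q<0)
        ; upper  = λ x y x∈U y∈U q∈ → fromWitness (inj₂ (x , y , x∈U , y∈U , q∈))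
        ; least  = λ b 0≤b ρ≤b → below {b} 0≤b ρ≤b ∘ toWitness
        }

    -- Dimensions start at -1, so the well-ordering of the naturals is applied to `m = d + 1`.
    -- Writing the index as `pred m + 1` gives the fine covers in the shape that
    -- `IsLebesgueDimension` expects.
    dimension≤ : ∀ n → HasFineCovers X (ℤ.+ suc n) → LebesgueDimension≤ X (ℤ.+ n)
    dimension≤ n fine =
      let m , m≤1+n , fine-m , min =
            least (λ m → HasFineCovers X (ℤ.pred (ℤ.+ m) ℤ.+ 1ℤ)) (suc n)
                  (subst (HasFineCovers X) (cong ℤ.+_ (ℕ.+-comm 1 n)) fine)
      in  ℤ.pred (ℤ.+ m)
        , record
          { -1≤d          = ℤ.pred-mono {ℤ.+ 0} {ℤ.+ m} (ℤ.+≤+ z≤n)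
          ; hasFineCovers = fine-m
          ; minimal       = λ
            { (ℤ.+ d)       _ fine-d → ℤ.pred-mono {ℤ.+ m} {ℤ.+ suc d} (ℤ.+≤+ (min (suc d) fine-d))
            ; ℤ.-[1+ zero ] _ fine-d → ℤ.pred-mono {ℤ.+ m} {ℤ.+ zero} (ℤ.+≤+ (min zero fine-d))
            ; ℤ.-[1+ suc _ ] (ℤ.-≤- ())
            }
          }
        , ℤ.pred-mono {ℤ.+ m} {ℤ.+ suc n} (ℤ.+≤+ m≤1+n)

    -- The two directions of the equivalence.

    HasHypergraph : ℤ → ℝ → Set _
    HasHypergraph k ε = ∃[ δ ] 0ᵣ <ᵣ δ × δ <ᵣ ε ×
      Σ (Hypergraph X) λ H → let open Hypergraph H in
        Rank≤ k ×
        (∀ x y → ρ x y <ᵣ δ → Nonempty (edge x ∩ edge y)) ×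
        (∀ x y → Nonempty (edge x ∩ edge y) → ρ x y <ᵣ ε) ×
        (∀ v → IsOpen X (Star v))

    -- Multiplicity counts sets up to `≐`, so a finite subcover has to be freed of repetitions up to
    -- `≐`; excluded middle makes that relation decidable.
    subset-decSetoid : DecSetoid _ _
    subset-decSetoid = record
      { Carrier          = Subset X
      ; isDecEquivalence = record { isEquivalence = ≐-isEquivalence ; _≟_ = λ _ _ → em }
      }

    covers⇒hypergraph : Compact X → ∀ n → HasFineCovers X (ℤ.+ n) →
                        ∀ ε → 0ᵣ <ᵣ ε → HasHypergraph (ℤ.+ n) ε
    covers⇒hypergraph compact n fine ε 0<ε =
      let open IsCover
          -- The mesh bound is not strict but distances must be strictly below `ε`, so the cover is
          -- taken with mesh a rational `e` below `ε`.
          e , 0<e , e∈ε           = positive-rational-below ε 0<ε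
          𝒞 , cover , mesh , mult = fine (fromℚ e) (0<fromℚ 0<e)
          Vs , Vs∈𝒞 , Vs-cover    = compact 𝒞 cover
      in  fromList e 0<e e∈ε 𝒞 (open-sets cover) mesh mult
            (deduplicate _≟_ Vs) (All.deduplicate⁺ _≟_ Vs∈𝒞)
            (deduplicate-! subset-decSetoid Vs)
            (λ x → Any.deduplicate⁺ _≟_ (λ U≐V x∈U → proj₂ U≐V x∈U) (Vs-cover x))
      where
      open DecSetoid subset-decSetoid using (_≟_)

      fromList : ∀ e → 0ℚ ℚ.< e → e ∈ lower ε → (𝒞 : Family X) →
        (∀ U → U ∈ 𝒞 → IsOpen X U) → IsMeshCover X (fromℚ e) 𝒞 →
        IsMultiplicityCover X (ℤ.+ n) 𝒞 →
        ∀ Us → All (_∈ 𝒞) Us → AllPairs (λ U V → ¬ (U ≐ V)) Us → (∀ x → Any (x ∈_) Us) →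
        HasHypergraph (ℤ.+ n) ε
      fromList e 0<e e∈ε 𝒞 opens mesh mult Us Us∈𝒞 distinct covers =
        let q , 0<q , number = lebesgue-number X compact Us (All.map (opens _) Us∈𝒞) covers
        -- Being at most the Lebesgue number `q` makes close points share a member; being at most
        -- `e` keeps `δ` below `ε`.
        in  fromℚ (q ⊓ e) , 0<fromℚ (0<⊓ 0<q 0<e)
          , ≤-<-transᵣ (fromℚ (q ⊓ e)) (fromℚ e) ε
              (fromℚ-mono-≤ (ℚ.p⊓q≤q q e)) (∈⇒fromℚ< ε e∈ε)
          , H
          , rank≤ H n edge≤n
          , (λ x y x<y → meet x y (number x y
              (<-≤-transᵣ (ρ x y) (fromℚ (q ⊓ e)) (fromℚ q) x<y (fromℚ-mono-≤ (ℚ.p⊓q≤p q e)))))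
          , close
          , star-open
        where
        contains? : ∀ x → Decidable (λ (U : Subset X) → x ∈ U)
        contains? x U = em

        edge : Carrier → FinSubset (length Us)
        edge x = selection (contains? x) Us

        edge⁺ : ∀ x v → x ∈ lookup Us v → v ∈ᶠ edge x
        edge⁺ x = ∈-selection⁺ (contains? x) Us

        edge⁻ : ∀ x v → v ∈ᶠ edge x → x ∈ lookup Us v
        edge⁻ x = ∈-selection⁻ (contains? x) Us

        member : ∀ v → lookup Us v ∈ 𝒞
        member v = All.lookup Us∈𝒞 (∈-lookup v)

        edge-⊆ : ∀ {x y} → x ≈ y → edge x ⊆ edge y
        edge-⊆ {x} {y} x≈y {v} v∈ =
          edge⁺ y v (open-respects-≈ X (opens _ (member v)) x≈y (edge⁻ x v v∈))

        H : Hypergraph X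
        H = record
          { order     = length Us
          ; edge      = edge
          ; edge-cong = λ x≈y → ⊆-antisym (edge-⊆ x≈y) (edge-⊆ (EqC.sym x≈y))
          }

        -- The size of the edge is the length of the list of those members of `Us` that contain `x`.
        -- These are pairwise distinct members of `𝒞` through `x`, so the multiplicity bound
        -- applies.
        edge≤n : ∀ x → ∣ edge x ∣ ℕ.≤ n
        edge≤n x = subst (ℕ._≤ n) (sym (∣selection∣ (contains? x) Us))
          (ℤ.drop‿+≤+ (mult x (filter (contains? x) Us)
            (All.filter⁺ (contains? x) Us∈𝒞)
            (All.all-filter (contains? x) Us)
            (AllPairs.filter⁺ (contains? x) distinct)))

        meet : ∀ x y → Any (λ U → x ∈ U × y ∈ U) Us → Nonempty (edge x ∩ edge y)
        meet x y common =
          let v = Any.index common ; x∈ , y∈ = Any.lookup-index common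
          in  v , x∈p∩q⁺ (edge⁺ x v x∈ , edge⁺ y v y∈)

        close : ∀ x y → Nonempty (edge x ∩ edge y) → ρ x y <ᵣ ε
        close x y (v , v∈) =
          let v∈x , v∈y          = x∈p∩q⁻ (edge x) (edge y) v∈
              d , diam , d≤e     = mesh (lookup Us v) (member v)
          in  ≤-<-transᵣ (ρ x y) (fromℚ e) ε
                (d≤e ∘ IsDiameter.upper diam x y (edge⁻ x v v∈x) (edge⁻ y v v∈y))
                (∈⇒fromℚ< ε e∈ε)

        star-open : ∀ v → IsOpen X (Hypergraph.Star H v)
        star-open v x v∈ =
          let r , 0<r , ball⊆U = opens _ (member v) x (edge⁻ x v v∈)
          in  r , 0<r , λ y x<y → edge⁺ y v (ball⊆U y x<y)

    hypergraph⇒covers : ∀ k → (∀ ε → 0ᵣ <ᵣ ε → HasHypergraph k ε) → HasFineCovers X k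
    hypergraph⇒covers k hyp ε 0<ε
      with δ , 0<δ , _ , H , (r , rank , r≤k) , meet , close , star-open ← hyp ε 0<ε =
      Stars , isCover , mesh , multiplicity
      where
      open Hypergraph H using (edge; Vertex; module IsRank)

      star : Vertex → Subset X
      star v x = Lift (c ⊔ ℓ) (x ∈ Hypergraph.Star H v)

      Stars : Family X
      Stars U = ∃[ v ] U ≡ star v

      isCover : IsCover X Stars
      isCover = record
        { open-sets = λ { _ (v , refl) x (lift v∈) →
            let s , 0<s , ball⊆ = star-open v x v∈
            in  s , 0<s , λ y x<y → lift (ball⊆ y x<y) }
        ; covers    = λ x →
            -- Since `ρ x x` is zero, hence below `δ`, the edge of `x` meets itself and is therefore
            -- nonempty.
            let v , v∈ = meet x x (ρ-< X δ EqC.refl 0<δ)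
            in  star v , (v , refl) , lift (proj₁ (x∈p∩q⁻ (edge x) (edge x) v∈))
        }

      mesh : IsMeshCover X ε Stars
      -- Two points of one star have the vertex `v` in common, so their distance is below `ε`; the
      -- supremum of these distances is then at most `ε`.
      mesh _ (v , refl) = diameter (star v) {ε} 0≤ε λ { x y (lift v∈x) (lift v∈y) →
          <⇒≤ᵣ (ρ x y) ε (close x y (v , x∈p∩q⁺ (v∈x , v∈y))) }
        where
        0≤ε : 0ᵣ ≤ᵣ ε
        0≤ε = <⇒≤ᵣ 0ᵣ ε 0<ε

      multiplicity : IsMultiplicityCover X k Stars
      multiplicity x Us stars x∈Us distinct = ℤ.≤-trans (ℤ.+≤+ (ℕ.≤-trans
        (length≤∣∣ star (λ U V → ¬ (U ≐ V)) (λ _ ≉ → ≉ ≐-refl) (edge x) Us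
          (All.zipWith (λ { ((v , refl) , lift v∈) → v , v∈ , refl }) (stars , x∈Us))
          distinct)
        (IsRank.upper rank x))) r≤k

theorem3 : (∀ {a} → ExcludedMiddle a) →
    ∀ {c ℓ} (X : MetricSpace c ℓ) → Compact X →
    let open MetricSpace X in
    (k : ℤ) → 1ℤ ≤ k →
    LebesgueDimension≤ X (k - 1ℤ) ⇔
    (∀ ε → 0ᵣ <ᵣ ε →
    ∃[ δ ] 0ᵣ <ᵣ δ × δ <ᵣ ε ×
    Σ (Hypergraph X) λ H →
    let open Hypergraph H in
    Rank≤ k ×
    (∀ x y → ρ x y <ᵣ δ → Nonempty (edge x ∩ edge y)) ×
    (∀ x y → Nonempty (edge x ∩ edge y) → ρ x y <ᵣ ε) ×
    (∀ v → IsOpen X (Star v)))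
-- As `k` is `n + 1`, the bound `k - 1` computes to `n`. A dimension `d` at most `n` gives covers of
-- multiplicity `d + 1`, which is at most `k`.
theorem3 em X compact ℤ.+[1+ n ] 1≤k = mk⇔
  (λ (d , dim , d≤n) → covers⇒hypergraph em X compact (suc n)
    (HasFineCovers-mono X
      (subst (d ℤ.+ 1ℤ ≤_) (cong ℤ.+_ (ℕ.+-comm n 1)) (ℤ.+-monoˡ-≤ 1ℤ d≤n))
      (IsLebesgueDimension.hasFineCovers dim)))
  (λ hyp → dimension≤ em X n (hypergraph⇒covers em X ℤ.+[1+ n ] hyp))
theorem3 em X compact (ℤ.+ zero) (ℤ.+≤+ ())
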